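{- Let $\Omega$ be a ranked signature and $\mathcal{T}_\Omega$ its set of ground terms. 1. For ground terms $s,t$, the single equality $A s \doteq B t$ has only finitely many solutions $A=r_1$, $B=r_2$ with templates $r_1,r_2$ of which at least one equals $\bullet$. 2. For ground terms $s_1\neq s_2$ and $t_1\neq t_2$, the conjunction $A s_1 \doteq B t_1 \wedge A s_2 \doteq B t_2$ either has no solution, or there are templates $r_1,r_2$, at least one of which equals $\bullet$, such that the conjunction is equivalent to $A r_1 \doteq B r_2$. In the latter case, $A=r_2$, $B=r_1$ is the single solution in which at least one of the templates equals $\bullet$. 3. For a finite conjunction $\bigwedge_{i=1}^k (A s_i \doteq B t_i)$ with ground terms $s_i,t_i$, the set of all solutions in which the template for $A$ or the template for $B$ equals $\bullet$ can be effectively computed.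
   Context: $\bullet$ is a fresh dedicated variable. A template is a term over $\Omega\cup\{\bullet\}$ containing at least one occurrence of $\bullet$; for a template $r$ and a term $u$, $ru$ denotes $r[u/\bullet]$ (substitution of $u$ for all occurrences of $\bullet$). $A,B$ are template variables ranging over templates. A solution of a conjunction of such equalities is an assignment of templates to $A,B$ under which both sides of every equality become syntactically identical terms. Two conjunctions are equivalent if they have the same solutions. -}

module Defs where

open import Data.Nat using (ℕ)
open import Data.Bool using (Bool; true; false; _∨_)
open import Data.Vec using (Vec; []; _∷_)
open import Data.List using (List)
open import Data.List.Relation.Unary.All using (All)
open import Data.Product using (_×_; _,_)
open import Data.Sum using (_⊎_)
open import Relation.Binary.PropositionalEquality using (_≡_)
open import Relation.Binary.Definitions using (DecidableEquality)

-- Symbols are assumed to have decidable equality (needed for part 3,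
-- "effectively computed", and for the constructive disjunction in part 2).
record Signature : Set₁ where
  field
    Symbol : Set
    arity  : Symbol → ℕ
    _≟_    : DecidableEquality Symbol

module WithSig (Ω : Signature) where
  open Signature Ω

  -- Terms over Ω ∪ {•}; the constructor • is the dedicated variable.
  data Tm : Set where
    •   : Tm
    app : (f : Symbol) → Vec Tm (arity f) → Tm

  hasHole  : Tm → Bool
  hasHoles : ∀ {n} → Vec Tm n → Bool
  hasHole •          = true
  hasHole (app f ts) = hasHoles ts
  hasHoles []       = false
  hasHoles (t ∷ ts) = hasHole t ∨ hasHoles ts

  Ground : Tm → Set
  Ground t = hasHole t ≡ false

  IsTemplate : Tm → Set
  IsTemplate r = hasHole r ≡ true

  _·_  : Tm → Tm → Tm
  subs : ∀ {n} → Vec Tm n → Tm → Vec Tm n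
  •        · u = u
  app f ts · u = app f (subs ts u)
  subs []       u = []
  subs (t ∷ ts) u = (t · u) ∷ subs ts u

  -- An equality  A u ≐ B v  is represented by the pair (u , v);
  -- a conjunction of equalities by a list of such pairs.
  Eqn : Set
  Eqn = Tm × Tm

  Holds : Tm → Tm → Eqn → Set
  Holds a b (u , v) = a · u ≡ b · v

  Solution : List Eqn → Tm → Tm → Set
  Solution es a b = IsTemplate a × IsTemplate b × All (Holds a b) es

  OneIsHole : Tm → Tm → Set
  OneIsHole a b = a ≡ • ⊎ b ≡ •

module Submission where

-- Terms over Ω ∪ {•} form a monoid under  r · u = r[u/•]  with unit •,
-- and contexts can be cancelled: if  x · s₁ ≡ y · s₁  and  x · s₂ ≡ y · s₂
-- with s₁ ≢ s₂ then x ≡ y (a non-hole context fixing a term is ground).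
--
-- (1) A solution with A = • or B = • means  s ≡ b · t  or  a · s ≡ t,
--     so the context is a "match" of one side against the other; matches
--     are enumerated by a finite list (the candidates).
-- (3) Filtering the candidates of the first equation with the decidable
--     predicate "solution of the conjunction with a hole" computes the set.
-- (2) Descending simultaneously along the two solution templates shows that
--     any solution of the two equations yields a common context r with
--     r · sᵢ ≡ tᵢ (or r · tᵢ ≡ sᵢ); whether one exists is decidable. By
--     cancellation, r · sᵢ ≡ tᵢ makes the conjunction equivalent to
--     A • ≐ B r, whose only hole solution is A = r, B = •.

open import Defs
open import Data.Bool using (true; false)
import Data.Bool as Bool
open import Data.Empty using (⊥-elim)
open import Data.List using (List; []; [_]; _∷_; _++_; map; filter; cartesianProductWith)
open import Data.List.Membership.Propositional using (_∈_; lose)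
open import Data.List.Membership.Propositional.Properties
  using (∈-++⁺ˡ; ∈-++⁺ʳ; ∈-map⁺; ∈-cartesianProductWith⁺; ∈-filter⁺; ∈-filter⁻)
open import Data.List.Relation.Unary.All using (All; []; _∷_; all?)
open import Data.List.Relation.Unary.Any using (here; any?; satisfied)
open import Data.Nat using (ℕ; suc; _+_; _≤_; _<_; s≤s)
open import Data.Nat.Properties using (≤-refl; ≤-trans; m≤m+n; m≤n+m; m≤n⇒m≤1+n; <-irrefl)
open import Data.Product using (Σ; ∃₂; _×_; _,_; proj₁; proj₂)
open import Data.Sum using (_⊎_; inj₁; inj₂) renaming ([_,_] to either)
open import Data.Vec using (Vec; []; _∷_)
open import Data.Vec.Properties using (∷-injectiveˡ; ∷-injectiveʳ)
open import Function.Bundles using (_⇔_; mk⇔; Equivalence)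
open import Relation.Binary.Definitions using (DecidableEquality)
open import Relation.Binary.PropositionalEquality
  using (_≡_; _≢_; refl; sym; trans; cong; cong₂; subst; module ≡-Reasoning)
open import Relation.Nullary using (¬_; Dec; yes; no)
open import Relation.Nullary.Decidable using (_×-dec_; _⊎-dec_)
open import Relation.Unary using (Decidable)

module Templates (Ω : Signature) where
  open Signature Ω
  open WithSig Ω
  open ≡-Reasoning

  app-head-injective : ∀ {f g us vs} → app f us ≡ app g vs → f ≡ g
  app-head-injective refl = refl

  app-injective : ∀ {f us vs} → app f us ≡ app f vs → us ≡ vs
  app-injective refl = refl

  infix 4 _≟T_ _≟Ts_
  _≟T_  : DecidableEquality Tm
  _≟Ts_ : ∀ {n} → DecidableEquality (Vec Tm n)
  • ≟T • = yes refl
  • ≟T app _ _ = no λ ()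
  app _ _ ≟T • = no λ ()
  app f us ≟T app g vs with f ≟ g
  ... | no f≢g = no λ e → f≢g (app-head-injective e)
  ... | yes refl with us ≟Ts vs
  ...   | yes refl = yes refl
  ...   | no us≢vs = no λ e → us≢vs (app-injective e)
  [] ≟Ts [] = yes refl
  (x ∷ xs) ≟Ts (y ∷ ys) with x ≟T y | xs ≟Ts ys
  ... | yes refl | yes refl = yes refl
  ... | no x≢y | _ = no λ e → x≢y (∷-injectiveˡ e)
  ... | _ | no xs≢ys = no λ e → xs≢ys (∷-injectiveʳ e)

  ·-identityʳ : ∀ r → r · • ≡ r
  subs-identityʳ : ∀ {n} (rs : Vec Tm n) → subs rs • ≡ rs
  ·-identityʳ • = refl
  ·-identityʳ (app f rs) = cong (app f) (subs-identityʳ rs)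
  subs-identityʳ [] = refl
  subs-identityʳ (r ∷ rs) = cong₂ _∷_ (·-identityʳ r) (subs-identityʳ rs)

  ·-assoc : ∀ x y z → (x · y) · z ≡ x · (y · z)
  subs-assoc : ∀ {n} (xs : Vec Tm n) y z → subs (subs xs y) z ≡ subs xs (y · z)
  ·-assoc • y z = refl
  ·-assoc (app f xs) y z = cong (app f) (subs-assoc xs y z)
  subs-assoc [] y z = refl
  subs-assoc (x ∷ xs) y z = cong₂ _∷_ (·-assoc x y z) (subs-assoc xs y z)

  ·-is-• : ∀ x y → x · y ≡ • → x ≡ • × y ≡ •
  ·-is-• • y e = refl , e
  ·-is-• (app f xs) y ()

  ground-absorbs : ∀ r u → Ground r → r · u ≡ r
  subs-ground-absorbs : ∀ {n} (rs : Vec Tm n) u → hasHoles rs ≡ false → subs rs u ≡ rs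
  ground-absorbs • u ()
  ground-absorbs (app f rs) u g = cong (app f) (subs-ground-absorbs rs u g)
  subs-ground-absorbs [] u g = refl
  subs-ground-absorbs (r ∷ rs) u g with hasHole r in gr
  subs-ground-absorbs (r ∷ rs) u () | true
  ... | false = cong₂ _∷_ (ground-absorbs r u gr) (subs-ground-absorbs rs u g)

  nonconstant⇒template : ∀ r {u₁ u₂ v₁ v₂} → r · u₁ ≡ v₁ → r · u₂ ≡ v₂ → v₁ ≢ v₂ → IsTemplate r
  nonconstant⇒template r {u₁} {u₂} e₁ e₂ v≢ with hasHole r in g
  ... | true = refl
  ... | false = ⊥-elim (v≢ (begin
    _       ≡⟨ sym e₁ ⟩
    r · u₁  ≡⟨ ground-absorbs r u₁ g ⟩
    r       ≡⟨ sym (ground-absorbs r u₂ g) ⟩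
    r · u₂  ≡⟨ e₂ ⟩
    _       ∎))

  size : Tm → ℕ
  sizes : ∀ {n} → Vec Tm n → ℕ
  size • = 1
  size (app f ts) = suc (sizes ts)
  sizes [] = 0
  sizes (t ∷ ts) = size t + sizes ts

  size-grows : ∀ r u → IsTemplate r → size u ≤ size (r · u)
  sizes-grow : ∀ {n} (rs : Vec Tm n) u → hasHoles rs ≡ true → size u ≤ sizes (subs rs u)
  size-grows • u h = ≤-refl
  size-grows (app f rs) u h = m≤n⇒m≤1+n (sizes-grow rs u h)
  sizes-grow [] u ()
  sizes-grow (r ∷ rs) u h with hasHole r in hr
  ... | true = ≤-trans (size-grows r u hr) (m≤m+n _ _)
  ... | false = ≤-trans (sizes-grow rs u h) (m≤n+m _ _)

  -- A non-hole context fixing some term is ground: otherwise r · u is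
  -- strictly larger than u.
  fixpoint-ground : ∀ f (rs : Vec Tm (arity f)) u → app f rs · u ≡ u → Ground (app f rs)
  fixpoint-ground f rs u e with hasHoles rs in h
  ... | false = refl
  ... | true = ⊥-elim (<-irrefl refl (subst (λ v → size u < size v) e (s≤s (sizes-grow rs u h))))

  fixpoint-unique : ∀ f (rs : Vec Tm (arity f)) {u₁ u₂} →
                    app f rs · u₁ ≡ u₁ → app f rs · u₂ ≡ u₂ → u₁ ≡ u₂
  fixpoint-unique f rs {u₁} {u₂} e₁ e₂ = begin
    u₁              ≡⟨ sym e₁ ⟩
    app f rs · u₁   ≡⟨ ground-absorbs (app f rs) u₁ g ⟩
    app f rs        ≡⟨ sym (ground-absorbs (app f rs) u₂ g) ⟩
    app f rs · u₂   ≡⟨ e₂ ⟩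
    u₂              ∎
    where g = fixpoint-ground f rs u₁ e₁

  cancel : ∀ x y {s₁ s₂} → s₁ ≢ s₂ → x · s₁ ≡ y · s₁ → x · s₂ ≡ y · s₂ → x ≡ y
  cancelᵛ : ∀ {n} (xs ys : Vec Tm n) {s₁ s₂} → s₁ ≢ s₂ →
            subs xs s₁ ≡ subs ys s₁ → subs xs s₂ ≡ subs ys s₂ → xs ≡ ys
  cancel • • ne e₁ e₂ = refl
  cancel • (app g ys) ne e₁ e₂ = ⊥-elim (ne (fixpoint-unique g ys (sym e₁) (sym e₂)))
  cancel (app f xs) • ne e₁ e₂ = ⊥-elim (ne (fixpoint-unique f xs e₁ e₂))
  cancel (app f xs) (app g ys) ne e₁ e₂ with app-head-injective e₁
  ... | refl = cong (app f) (cancelᵛ xs ys ne (app-injective e₁) (app-injective e₂))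
  cancelᵛ [] [] ne e₁ e₂ = refl
  cancelᵛ (x ∷ xs) (y ∷ ys) ne e₁ e₂ =
    cong₂ _∷_ (cancel x y ne (∷-injectiveˡ e₁) (∷-injectiveˡ e₂))
              (cancelᵛ xs ys ne (∷-injectiveʳ e₁) (∷-injectiveʳ e₂))

  holeIf : ∀ {s t : Tm} → Dec (s ≡ t) → List Tm
  holeIf (yes _) = [ • ]
  holeIf (no _) = []

  holeIf-∈ : ∀ {s t} (d : Dec (s ≡ t)) → s ≡ t → • ∈ holeIf d
  holeIf-∈ (yes _) e = here refl
  holeIf-∈ (no s≢t) e = ⊥-elim (s≢t e)

  matches : Tm → Tm → List Tm
  matchesᵛ : ∀ {n} → Tm → Vec Tm n → List (Vec Tm n)
  matches t • = holeIf (• ≟T t)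
  matches t (app f ss) = holeIf (app f ss ≟T t) ++ map (app f) (matchesᵛ t ss)
  matchesᵛ t [] = [ [] ]
  matchesᵛ t (s ∷ ss) = cartesianProductWith _∷_ (matches t s) (matchesᵛ t ss)

  matches-complete : ∀ r t → r ∈ matches t (r · t)
  matchesᵛ-complete : ∀ {n} (rs : Vec Tm n) t → rs ∈ matchesᵛ t (subs rs t)
  matches-complete • • = holeIf-∈ (• ≟T •) refl
  matches-complete • (app f ts) = ∈-++⁺ˡ (holeIf-∈ (app f ts ≟T app f ts) refl)
  matches-complete (app f rs) t =
    ∈-++⁺ʳ (holeIf (app f (subs rs t) ≟T t)) (∈-map⁺ (app f) (matchesᵛ-complete rs t))
  matchesᵛ-complete [] t = here refl
  matchesᵛ-complete (r ∷ rs) t =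
    ∈-cartesianProductWith⁺ _∷_ (matches-complete r t) (matchesᵛ-complete rs t)

  candidates : Tm → Tm → List (Tm × Tm)
  candidates s t = map (• ,_) (matches t s) ++ map (_, •) (matches s t)

  candidates-complete : ∀ {s t a b} → a · s ≡ b · t → OneIsHole a b → (a , b) ∈ candidates s t
  candidates-complete {s} {t} {b = b} e (inj₁ refl) =
    ∈-++⁺ˡ (∈-map⁺ (• ,_) (subst (λ u → b ∈ matches t u) (sym e) (matches-complete b t)))
  candidates-complete {s} {t} {a} e (inj₂ refl) =
    ∈-++⁺ʳ (map (• ,_) (matches t s)) (∈-map⁺ (_, •) (subst (λ u → a ∈ matches s u) e (matches-complete a s)))

  solution? : ∀ es a b → Dec (Solution es a b)
  solution? es a b = template? a ×-dec template? b ×-dec all? holds? es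
    where
    template? : ∀ r → Dec (IsTemplate r)
    template? r = hasHole r Bool.≟ true
    holds? : Decidable (Holds a b)
    holds? (u , v) = a · u ≟T b · v

  HoleSolution : List Eqn → Tm × Tm → Set
  HoleSolution es (a , b) = Solution es a b × OneIsHole a b

  hole-solution? : ∀ es → Decidable (HoleSolution es)
  hole-solution? es (a , b) = solution? es a b ×-dec (a ≟T • ⊎-dec b ≟T •)

  hole-solutions : ∀ s₀ t₀ es → Σ (List (Tm × Tm)) λ L →
                   ∀ a b → ((a , b) ∈ L) ⇔ HoleSolution ((s₀ , t₀) ∷ es) (a , b)
  hole-solutions s₀ t₀ es = filter (hole-solution? es′) (candidates s₀ t₀) , λ a b →
    mk⇔ (λ m → proj₂ (∈-filter⁻ (hole-solution? es′) {xs = candidates s₀ t₀} m))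
        (λ { sol@((_ , _ , e ∷ _) , hole) →
               ∈-filter⁺ (hole-solution? es′) (candidates-complete e hole) sol })
    where es′ = (s₀ , t₀) ∷ es

  Context : Tm → Tm → Tm → Tm → Set
  Context s₁ s₂ t₁ t₂ = Σ Tm λ r → r · s₁ ≡ t₁ × r · s₂ ≡ t₂

  -- Such a context can only be a match of s₁ against t₁, so its existence
  -- is decidable.
  context? : ∀ s₁ s₂ t₁ t₂ → Dec (Context s₁ s₂ t₁ t₂)
  context? s₁ s₂ t₁ t₂ with any? (λ r → (r · s₁ ≟T t₁) ×-dec (r · s₂ ≟T t₂)) (matches s₁ t₁)
  ... | yes found = yes (satisfied found)
  ... | no none = no λ { (r , e₁ , e₂) →
          none (lose (subst (λ u → r ∈ matches s₁ u) e₁ (matches-complete r s₁)) (e₁ , e₂)) }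

  -- Any solution of two equations comes from a common context: descend
  -- along both templates until one of them is •.
  common-context : ∀ a b {s₁ s₂ t₁ t₂} → IsTemplate a →
                   a · s₁ ≡ b · t₁ → a · s₂ ≡ b · t₂ →
                   Context s₁ s₂ t₁ t₂ ⊎ Context t₁ t₂ s₁ s₂
  common-contextᵛ : ∀ {n} (as bs : Vec Tm n) {s₁ s₂ t₁ t₂} → hasHoles as ≡ true →
                    subs as s₁ ≡ subs bs t₁ → subs as s₂ ≡ subs bs t₂ →
                    Context s₁ s₂ t₁ t₂ ⊎ Context t₁ t₂ s₁ s₂
  common-context • b h e₁ e₂ = inj₂ (b , sym e₁ , sym e₂)
  common-context (app f as) • h e₁ e₂ = inj₁ (app f as , e₁ , e₂)
  common-context (app f as) (app g bs) h e₁ e₂ with app-head-injective e₁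
  ... | refl = common-contextᵛ as bs h (app-injective e₁) (app-injective e₂)
  common-contextᵛ (x ∷ xs) (y ∷ ys) h e₁ e₂ with hasHole x in hx
  ... | true = common-context x y hx (∷-injectiveˡ e₁) (∷-injectiveˡ e₂)
  ... | false = common-contextᵛ xs ys h (∷-injectiveʳ e₁) (∷-injectiveʳ e₂)

  -- If x · sᵢ ≡ tᵢ for distinct s₁, s₂, then  a · sᵢ ≡ b · tᵢ (i = 1, 2)
  -- holds exactly when a ≡ b · x (by associativity and cancellation).
  context-solution : ∀ {x s₁ s₂ t₁ t₂} → s₁ ≢ s₂ → x · s₁ ≡ t₁ → x · s₂ ≡ t₂ →
                     ∀ a b → (a · s₁ ≡ b · t₁ × a · s₂ ≡ b · t₂) ⇔ (a ≡ b · x)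
  context-solution {x} {s₁} {s₂} s≢ x₁ x₂ a b =
    mk⇔ (λ (e₁ , e₂) → cancel a (b · x) s≢ (trans e₁ (via x₁)) (trans e₂ (via x₂)))
        (λ { refl → sym (via x₁) , sym (via x₂) })
    where
    via : ∀ {s t} → x · s ≡ t → b · t ≡ (b · x) · s
    via {s} refl = sym (·-assoc b x s)

  swapped-solves : ∀ {r₁ r₂} → OneIsHole r₁ r₂ → r₂ · r₁ ≡ r₁ · r₂
  swapped-solves {r₂ = r₂} (inj₁ refl) = ·-identityʳ r₂
  swapped-solves {r₁} (inj₂ refl) = sym (·-identityʳ r₁)

  hole-solution-unique : ∀ {r₁ r₂ a b} → OneIsHole r₁ r₂ → a · r₁ ≡ b · r₂ →
                         OneIsHole a b → a ≡ r₂ × b ≡ r₁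
  hole-solution-unique {r₂ = r₂} {b = b} (inj₁ refl) e (inj₁ refl) =
    let b≡• , r₂≡• = ·-is-• b r₂ (sym e) in sym r₂≡• , b≡•
  hole-solution-unique {a = a} (inj₁ refl) e (inj₂ refl) = trans (sym (·-identityʳ a)) e , refl
  hole-solution-unique {b = b} (inj₂ refl) e (inj₁ refl) = refl , sym (trans e (·-identityʳ b))
  hole-solution-unique {r₁} {a = a} (inj₂ refl) e (inj₂ refl) =
    let a≡• , r₁≡• = ·-is-• a r₁ e in a≡• , sym r₁≡•

  ReducesToSingle : List Eqn → Set
  ReducesToSingle es =
    Σ Tm λ r₁ → Σ Tm λ r₂ →
      IsTemplate r₁ × IsTemplate r₂ × OneIsHole r₁ r₂
      × (∀ a b → Solution es a b ⇔ Solution [ (r₁ , r₂) ] a b)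
      × Solution es r₂ r₁
      × (∀ a b → Solution es a b → OneIsHole a b → a ≡ r₂ × b ≡ r₁)

  reduces-to-single : ∀ {es r₁ r₂} → IsTemplate r₁ → IsTemplate r₂ → OneIsHole r₁ r₂ →
                      (∀ a b → Solution es a b ⇔ Solution [ (r₁ , r₂) ] a b) →
                      ReducesToSingle es
  reduces-to-single {r₁ = r₁} {r₂} τ₁ τ₂ hole equiv =
    r₁ , r₂ , τ₁ , τ₂ , hole , equiv
    , Equivalence.from (equiv r₂ r₁) (τ₂ , τ₁ , swapped-solves hole ∷ [])
    , λ a b sol → unique (Equivalence.to (equiv a b) sol)
    where
    unique : ∀ {a b} → Solution [ (r₁ , r₂) ] a b → OneIsHole a b → a ≡ r₂ × b ≡ r₁
    unique (_ , _ , e ∷ []) = hole-solution-unique hole e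

  pair⇔single : ∀ {s₁ s₂ t₁ t₂ r₁ r₂} →
                (∀ a b → (a · s₁ ≡ b · t₁ × a · s₂ ≡ b · t₂) ⇔ (a · r₁ ≡ b · r₂)) →
                ∀ a b → Solution ((s₁ , t₁) ∷ (s₂ , t₂) ∷ []) a b ⇔ Solution [ (r₁ , r₂) ] a b
  pair⇔single equiv a b =
    mk⇔ (λ { (τa , τb , e₁ ∷ e₂ ∷ []) → τa , τb , Equivalence.to (equiv a b) (e₁ , e₂) ∷ [] })
        (λ { (τa , τb , e ∷ []) → let e₁ , e₂ = Equivalence.from (equiv a b) e in
                                   τa , τb , e₁ ∷ e₂ ∷ [] })

  two-equations : ∀ s₁ s₂ t₁ t₂ → s₁ ≢ s₂ → t₁ ≢ t₂ →
                  ¬ (∃₂ λ a b → Solution ((s₁ , t₁) ∷ (s₂ , t₂) ∷ []) a b)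
                  ⊎ ReducesToSingle ((s₁ , t₁) ∷ (s₂ , t₂) ∷ [])
  two-equations s₁ s₂ t₁ t₂ s≢ t≢ with context? s₁ s₂ t₁ t₂ | context? t₁ t₂ s₁ s₂
  ... | yes (x , x₁ , x₂) | _ =
    inj₂ (reduces-to-single refl (nonconstant⇒template x x₁ x₂ t≢) (inj₁ refl) (pair⇔single equiv))
    where
    equiv : ∀ a b → (a · s₁ ≡ b · t₁ × a · s₂ ≡ b · t₂) ⇔ (a · • ≡ b · x)
    equiv a b = let eqv = context-solution s≢ x₁ x₂ a b in
      mk⇔ (λ es → trans (·-identityʳ a) (Equivalence.to eqv es))
          (λ e → Equivalence.from eqv (trans (sym (·-identityʳ a)) e))
  ... | no _ | yes (y , y₁ , y₂) =
    inj₂ (reduces-to-single (nonconstant⇒template y y₁ y₂ s≢) refl (inj₂ refl) (pair⇔single equiv))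
    where
    equiv : ∀ a b → (a · s₁ ≡ b · t₁ × a · s₂ ≡ b · t₂) ⇔ (a · y ≡ b · •)
    equiv a b = let eqv = context-solution t≢ y₁ y₂ b a in
      mk⇔ (λ (e₁ , e₂) → trans (sym (Equivalence.to eqv (sym e₁ , sym e₂))) (sym (·-identityʳ b)))
          (λ e → let e₁ , e₂ = Equivalence.from eqv (sym (trans e (·-identityʳ b))) in
                 sym e₁ , sym e₂)
  ... | no no-context | no no-context′ = inj₁ λ { (a , b , τa , _ , e₁ ∷ e₂ ∷ []) →
          either no-context no-context′ (common-context a b τa e₁ e₂) }

theorem2 : (Ω : Signature) → let open WithSig Ω in
    (∀ (s t : Tm) → Ground s → Ground t →
       Σ (List (Tm × Tm)) λ L →
         ∀ (r₁ r₂ : Tm) → Solution [ (s , t) ] r₁ r₂ → OneIsHole r₁ r₂ →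
           (r₁ , r₂) ∈ L)
    ×
    (∀ (s₁ s₂ t₁ t₂ : Tm) → Ground s₁ → Ground s₂ → Ground t₁ → Ground t₂ →
       s₁ ≢ s₂ → t₁ ≢ t₂ →
       (¬ (∃₂ λ a b → Solution ((s₁ , t₁) ∷ (s₂ , t₂) ∷ []) a b))
       ⊎
       (Σ Tm λ r₁ → Σ Tm λ r₂ →
          IsTemplate r₁ × IsTemplate r₂ × OneIsHole r₁ r₂
          × (∀ (a b : Tm) →
               Solution ((s₁ , t₁) ∷ (s₂ , t₂) ∷ []) a b
                 ⇔ Solution [ (r₁ , r₂) ] a b)
          × Solution ((s₁ , t₁) ∷ (s₂ , t₂) ∷ []) r₂ r₁
          × (∀ (a b : Tm) →
               Solution ((s₁ , t₁) ∷ (s₂ , t₂) ∷ []) a b →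
               OneIsHole a b → (a ≡ r₂ × b ≡ r₁))))
    ×
    (∀ (es : List (Tm × Tm)) → es ≢ [] →
       All (λ e → Ground (proj₁ e) × Ground (proj₂ e)) es →
       Σ (List (Tm × Tm)) λ L →
         ∀ (a b : Tm) → ((a , b) ∈ L) ⇔ (Solution es a b × OneIsHole a b))
theorem2 Ω =
    (λ s t _ _ → candidates s t , λ { a b (_ , _ , e ∷ []) → candidates-complete e })
  , (λ s₁ s₂ t₁ t₂ _ _ _ _ → two-equations s₁ s₂ t₁ t₂)
  , λ { [] nonempty _ → ⊥-elim (nonempty refl)
      ; ((s₀ , t₀) ∷ es) _ _ → hole-solutions s₀ t₀ es }
  where open Templates Ω
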